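{- Let $p_1\in[0,1]$ and let $PG_n$ be the random pentagonal chain network described in the context. Then for every $n\geq 1$, $$\mathbb{E}\big(S(PG_{n})\big)=(60-20p_{1})n^{3}+(60p_{1}+7)n^{2}-(40p_{1}+7)n.$$
   Context: Random chain network $PG_n$: $PG_1$ is a $5$-cycle (pentagon). For $n\ge 1$, $PG_{n+1}$ is obtained from $PG_n$ by adding a new pentagon $O_{n+1}$ with vertices $x_1,x_2,x_3,x_4,x_5$ in cyclic (clockwise) order and adding one edge joining $x_1$ to a vertex $u_n$ of $PG_n$. The vertex $u_1$ is any vertex of $PG_1$ (all are equivalent). For $n\ge 2$, $u_n$ is a vertex of the last pentagon $O_n$ (whose vertex $x_1$ is the one joined to $u_{n-1}$): with probability $p_1$ one takes $u_n\in\{x_2,x_5\}$ of $O_n$ (the two neighbours of $x_1$ in $O_n$), and with probability $p_2=1-p_1$ one takes $u_n\in\{x_3,x_4\}$ of $O_n$ (the two vertices at distance $2$ from $x_1$ in $O_n$); $p_1,p_2$ do not depend on the step. Thus $PG_n$ has $5n$ vertices. For a graph $G$, $d(v)$ denotes the degree of vertex $v$ and $d(u,v)$ the shortest-path distance. The Schultz index is $S(G)=\sum_{\{u,v\}\subseteq V_G} \big(d(u)+d(v)\big)\,d(u,v)$, the sum over unordered pairs of distinct vertices. -}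

module Defs where

open import Level using (0ℓ; _⊔_) renaming (suc to lsuc)
open import Data.Bool.Base using (if_then_else_)
open import Data.Nat.Base using (ℕ; zero; suc)
import Data.Nat.Properties as ℕ
open import Data.Nat.DivMod using (_%_)
open import Data.Fin.Base using (Fin; zero; suc; toℕ; splitAt; _↑ˡ_)
open import Data.Fin.Patterns using (0F; 1F; 2F; 3F; 4F)
open import Data.Fin.Properties using (_≟_; _<?_; any?)
open import Data.Sum.Base using (_⊎_; inj₁; inj₂; swap)
open import Data.Product.Base using (_×_; _,_; ∃-syntax)
open import Data.Vec.Base using (Vec; []; _∷_; allFin; count)
open import Relation.Nullary using (Dec; does; yes; no; ¬_; contradiction)
open import Relation.Nullary.Decidable using (map′; _×-dec_; _⊎-dec_)
open import Relation.Binary.Core using (Rel)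
open import Relation.Binary.Definitions using (Decidable; Symmetric; Irreflexive)
open import Relation.Binary.Structures using (IsPartialOrder)
open import Relation.Binary.PropositionalEquality using (_≡_; refl; subst)
open import Algebra.Bundles using (CommutativeRing; Semiring)
import Algebra.Definitions.RawMonoid as RawMonoidDefs
import Algebra.Definitions.RawSemiring as RawSemiringDefs

------------------------------------------------------------------------
-- Scalars

-- The stand-in for ℝ, which is not available: a commutative ring with a
-- compatible partial order. ℝ (classical or constructive) is an instance.
record OrderedCommutativeRing c ℓ₁ ℓ₂ : Set (lsuc (c ⊔ ℓ₁ ⊔ ℓ₂)) where
  infix 4 _≤_
  field
    commutativeRing : CommutativeRing c ℓ₁
  open CommutativeRing commutativeRing public
  field
    _≤_            : Rel Carrier ℓ₂
    isPartialOrder : IsPartialOrder _≈_ _≤_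
    +-monoˡ-≤      : ∀ z {x y} → x ≤ y → x + z ≤ y + z
    *-nonNegative  : ∀ {x y} → 0# ≤ x → 0# ≤ y → 0# ≤ x * y

  open RawSemiringDefs (Semiring.rawSemiring semiring) public using (_^_)
  open RawMonoidDefs (Semiring.+-rawMonoid semiring) public using (sum) renaming (_×_ to _·_)

  fromℕ : ℕ → Carrier
  fromℕ n = n · 1#

------------------------------------------------------------------------
-- The random attaching vertices

-- The vertices x₁, x₂, x₃, x₄, x₅ of a pentagon are 0F, 1F, 2F, 3F, 4F, in
-- cyclic order. A vector uₖ ∷ … ∷ u₁ ∷ [] lists attaching vertices, the most
-- recent first; each uᵢ is a vertex of the i-th pentagon.
module Random {c ℓ₁ ℓ₂} (R : OrderedCommutativeRing c ℓ₁ ℓ₂) where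
  open OrderedCommutativeRing R

  -- weight us u is the conditional probability that the next attaching vertex
  -- is u, given that the previous ones are us. Only the total probabilities of
  -- {x₂, x₅} and of {x₃, x₄} are prescribed, and they are the same for every
  -- history, so the near/far choices are independent of each other; how the
  -- mass is split inside the two pairs is left arbitrary, as is the law of u₁.
  record AttachmentLaw (p₁ : Carrier) : Set (c ⊔ ℓ₁ ⊔ ℓ₂) where
    p₂ : Carrier
    p₂ = 1# - p₁
    field
      weight      : ∀ {k} → Vec (Fin 5) k → Fin 5 → Carrier
      nonNegative : ∀ {k} (us : Vec (Fin 5) k) u → 0# ≤ weight us u
      first       : sum (weight []) ≈ 1#
      not-x₁      : ∀ {k} (us : Vec (Fin 5) (suc k)) → weight us 0F ≈ 0#
      near        : ∀ {k} (us : Vec (Fin 5) (suc k)) → weight us 1F + weight us 4F ≈ p₁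
      far         : ∀ {k} (us : Vec (Fin 5) (suc k)) → weight us 2F + weight us 3F ≈ p₂

  sumVec : ∀ k → (Vec (Fin 5) k → Carrier) → Carrier
  sumVec zero    f = f []
  sumVec (suc k) f = sum λ u → sumVec k λ us → f (u ∷ us)

  module _ {p₁ : Carrier} (law : AttachmentLaw p₁) where
    open AttachmentLaw law

    probability : ∀ {k} → Vec (Fin 5) k → Carrier
    probability []       = 1#
    probability (u ∷ us) = probability us * weight us u

    𝔼 : ∀ {k} → (Vec (Fin 5) k → Carrier) → Carrier
    𝔼 {k} X = sumVec k λ us → probability us * X us

------------------------------------------------------------------------
-- Finite simple graphs

open import Data.Nat.Base using (_+_; _*_; _≤_; z≤n; +-0-rawMonoid)
open RawMonoidDefs +-0-rawMonoid using (sum)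

record Graph (n : ℕ) : Set₁ where
  field
    Adj    : Rel (Fin n) 0ℓ
    adj?   : Decidable Adj
    symm   : Symmetric Adj
    irrefl : Irreflexive _≡_ Adj

module _ {n : ℕ} (G : Graph n) where
  open Graph G

  degree : Fin n → ℕ
  degree i = count (adj? i) (allFin n)

  data Walk : Fin n → Fin n → ℕ → Set where
    []  : ∀ {i} → Walk i i 0
    _∷_ : ∀ {i j k l} → Adj i j → Walk j k l → Walk i k (suc l)

  walk? : ∀ i j l → Dec (Walk i j l)
  walk? i j zero    = map′ (λ { refl → [] }) (λ { [] → refl }) (i ≟ j)
  walk? i j (suc l) = map′ (λ { (k , a , w) → a ∷ w }) (λ { (a ∷ w) → _ , a , w })
                           (any? (λ k → adj? i k ×-dec walk? k j l))

  -- The least l ≥ start with a walk of length l from i to j, examining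
  -- only the values start, …, start + fuel − 1; start + fuel if there is none.
  leastWalk : Fin n → Fin n → (fuel start : ℕ) → ℕ
  leastWalk i j zero       start = start
  leastWalk i j (suc fuel) start =
    if does (walk? i j start) then start else leastWalk i j fuel (suc start)

  -- Two connected vertices are joined by a walk of length < n, so for these
  -- the search finds the shortest-path distance; for vertices in different
  -- components the value is the junk value n (PG below is connected).
  dist : Fin n → Fin n → ℕ
  dist i j = leastWalk i j n 0

  IsDistance : Fin n → Fin n → ℕ → Set
  IsDistance i j d = Walk i j d × (∀ l → Walk i j l → d ≤ l)

  private
    leastWalk-correct : ∀ i j fuel start →
      (∀ l → Walk i j l → start ≤ l) →
      (∃[ l ] l ≤ start + fuel × Walk i j l) →
      IsDistance i j (leastWalk i j fuel start)
    leastWalk-correct i j zero start low (l , l≤ , w) = subst (Walk i j)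
      (ℕ.≤-antisym (subst (l ≤_) (ℕ.+-identityʳ start) l≤) (low l w)) w , low
    leastWalk-correct i j (suc fuel) start low (l , l≤ , w) with walk? i j start
    ... | yes v = v , low
    ... | no ¬v = leastWalk-correct i j fuel (suc start) low′
                    (l , subst (l ≤_) (ℕ.+-suc start fuel) l≤ , w)
      where
      low′ : ∀ m → Walk i j m → suc start ≤ m
      low′ m x with ℕ.m≤n⇒m<n∨m≡n (low m x)
      ... | inj₁ s<m  = s<m
      ... | inj₂ refl = contradiction x ¬v

  dist-correct : ∀ i j → (∃[ l ] l ≤ n × Walk i j l) → IsDistance i j (dist i j)
  dist-correct i j = leastWalk-correct i j n 0 (λ _ _ → z≤n)

  -- Unordered pairs {i, j} of distinct vertices are listed as i < j.
  schultz : ℕ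
  schultz = sum λ i → sum λ j →
    if does (i <? j) then (degree i + degree j) * dist i j else 0

------------------------------------------------------------------------
-- Pentagonal chains

Next : Rel (Fin 5) 0ℓ
Next i j = toℕ j ≡ suc (toℕ i) % 5

pentagon : Graph 5
pentagon = record
  { Adj    = λ i j → Next i j ⊎ Next j i
  ; adj?   = λ i j → (toℕ j ℕ.≟ suc (toℕ i) % 5) ⊎-dec (toℕ i ℕ.≟ suc (toℕ j) % 5)
  ; symm   = swap
  ; irrefl = λ { {i} refl (inj₁ e) → irr i e ; {i} refl (inj₂ e) → irr i e }
  }
  where
  irr : ∀ i → ¬ Next i i
  irr 0F ()
  irr 1F ()
  irr 2F ()
  irr 3F ()
  irr 4F ()

-- A new pentagon, whose vertices come first in Fin (5 + m), is added to G
-- together with the single edge joining its vertex x₁ to the vertex u of G.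
module _ {m : ℕ} (G : Graph m) (u : Fin m) where
  private
    module G = Graph G
    module C = Graph pentagon

  Adj⊎ : Rel (Fin 5 ⊎ Fin m) 0ℓ
  Adj⊎ (inj₁ a) (inj₁ b) = C.Adj a b
  Adj⊎ (inj₁ a) (inj₂ y) = a ≡ 0F × y ≡ u
  Adj⊎ (inj₂ x) (inj₁ b) = b ≡ 0F × x ≡ u
  Adj⊎ (inj₂ x) (inj₂ y) = G.Adj x y

  adj⊎? : Decidable Adj⊎
  adj⊎? (inj₁ a) (inj₁ b) = C.adj? a b
  adj⊎? (inj₁ a) (inj₂ y) = (a ≟ 0F) ×-dec (y ≟ u)
  adj⊎? (inj₂ x) (inj₁ b) = (b ≟ 0F) ×-dec (x ≟ u)
  adj⊎? (inj₂ x) (inj₂ y) = G.adj? x y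

  symm⊎ : Symmetric Adj⊎
  symm⊎ {inj₁ a} {inj₁ b} = C.symm {a} {b}
  symm⊎ {inj₁ a} {inj₂ y} e = e
  symm⊎ {inj₂ x} {inj₁ b} e = e
  symm⊎ {inj₂ x} {inj₂ y} = G.symm

  irrefl⊎ : ∀ v → ¬ Adj⊎ v v
  irrefl⊎ (inj₁ a) = C.irrefl {a} refl
  irrefl⊎ (inj₂ x) = G.irrefl refl

  addPentagon : Graph (5 + m)
  addPentagon = record
    { Adj    = λ i j → Adj⊎ (splitAt 5 i) (splitAt 5 j)
    ; adj?   = λ i j → adj⊎? (splitAt 5 i) (splitAt 5 j)
    ; symm   = λ {i} {j} → symm⊎ {splitAt 5 i} {splitAt 5 j}
    ; irrefl = λ { {i} refl → irrefl⊎ (splitAt 5 i) }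
    }

-- The chain PGₙ with n = suc k pentagons; its last pentagon is the one whose
-- vertices come first, so u ↑ˡ (k * 5) is the vertex u of the last pentagon.
PG : ∀ {k} → Vec (Fin 5) k → Graph (suc k * 5)
PG             []       = pentagon
PG {k = suc k} (u ∷ us) = addPentagon (PG us) (u ↑ˡ (k * 5))

{-# OPTIONS --safe #-}

-- The new edge is a bridge, so distances and degrees in the enlarged graph are
-- explicit, and attaching a pentagon at u raises the Schultz index by
--   55 + 247 n + 12 Σ_y d(u,y) + 5 Σ_y d(y) d(u,y),
-- the sums being over PGₙ. When u lies at distance δ from x₁ in the last
-- pentagon, the combination 12 Σ + 5 Σ itself exceeds the one for the previous
-- attaching vertex by 127 + 120 (n − 1)(δ + 1). Given the past, δ + 1 has mean
-- 2 p₁ + 3 p₂ = 3 − p₁, so both recurrences can be averaged and summed.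

module Submission where

open import Defs
open import Data.Nat.Base using (ℕ; zero; suc)
import Data.Nat.Base as ℕ
open import Data.Fin.Base using (Fin)
open import Data.Fin.Patterns using (0F; 1F; 2F; 3F; 4F)
open import Data.Vec.Base using (Vec; []; _∷_; head; tail)
open import Function.Base using (_∘_)
import Relation.Binary.PropositionalEquality as ≡
import Algebra.Properties.Semiring.Sum as SemiringSum
import Algebra.Properties.Semiring.Mult as SemiringMult
import Algebra.Properties.Ring as RingProperties
import Algebra.Solver.Ring.NaturalCoefficients.Default as NaturalCoefficients
import Relation.Binary.Reasoning.Setoid as SetoidReasoning

module PentagonalChains where
  open import Data.Bool.Base using (true; false; if_then_else_)
  open import Data.Nat.Base using (_+_; _*_; _≤_; z≤n; s≤s)
  import Data.Nat.Properties as ℕ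
  open import Data.Nat.Tactic.RingSolver using (solve-∀)
  open import Data.Fin.Base using (zero; suc; splitAt; join; _↑ˡ_; _↑ʳ_)
  open import Data.Fin.Properties using (_≟_; _<?_; all?; splitAt-↑ˡ; join-splitAt)
  open import Data.Sum.Base using (_⊎_; inj₁; inj₂)
  open import Data.Product.Base using (_×_; _,_; proj₁; proj₂; ∃-syntax)
  open import Data.Vec.Base using (count; tabulate)
  open import Function.Base using (id)
  open import Relation.Nullary using (Dec; does)
  open import Relation.Nullary.Decidable using (toWitness; _×-dec_)
  open import Relation.Unary using (Pred) renaming (Decidable to Decidable₁)
  open import Relation.Binary.PropositionalEquality
    using (_≡_; refl; sym; trans; cong; cong₂; subst; subst₂; module ≡-Reasoning)
  open import Algebra.Properties.Semiring.Sum ℕ.+-*-semiring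

  -- Finite sums of natural numbers

  indicator : ∀ {p} {P : Set p} → Dec P → ℕ
  indicator P? = if does P? then 1 else 0

  -- Turns degrees into sums. A general `tabulate f` is needed because counting past the five new
  -- vertices of an enlarged graph leaves a `tabulate` of `inr`.
  count-tabulate : ∀ {a p} {A : Set a} {P : Pred A p} (P? : Decidable₁ P) {n} (f : Fin n → A) →
                   count P? (tabulate f) ≡ sum (λ i → indicator (P? (f i)))
  count-tabulate P? {zero}  f = refl
  count-tabulate P? {suc n} f with does (P? (f zero))
  ... | true  = cong suc (count-tabulate P? (f ∘ suc))
  ... | false = count-tabulate P? (f ∘ suc)

  sum-zero : ∀ {n} (f : Fin n → ℕ) → (∀ i → f i ≡ 0) → sum f ≡ 0
  sum-zero {n} f f≡0 = trans (sum-cong-≗ f≡0) (sum-replicate-zero n)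

  sum-point : ∀ {n} (u : Fin n) (f : Fin n → ℕ) → sum (λ y → indicator (y ≟ u) * f y) ≡ f u
  sum-point {suc n} zero f = begin
    f zero + 0 + sum {n} (λ _ → 0)  ≡⟨ cong (f zero + 0 +_) (sum-zero {n} _ λ _ → refl) ⟩
    f zero + 0 + 0                  ≡⟨ trans (ℕ.+-identityʳ _) (ℕ.+-identityʳ _) ⟩
    f zero                          ∎
    where open ≡-Reasoning
  sum-point {suc n} (suc u) f = sum-point u (f ∘ suc)

  sum-indicator : ∀ {n} (u : Fin n) → sum (λ y → indicator (y ≟ u)) ≡ 1
  sum-indicator u = trans (sum-cong-≗ λ y → sym (ℕ.*-identityʳ (indicator (y ≟ u)))) (sum-point u λ _ → 1)

  -- Of the two terms of `(w i + w j) * d i j`, the first goes to row `i` and the second, by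
  -- symmetry, to row `j`. The induction removes the vertex `zero`, whose pairs supply row `zero`
  -- and the entry in column `zero` of every other row.
  sum-pairs : ∀ {n} (w : Fin n → ℕ) (d : Fin n → Fin n → ℕ) →
              (∀ i → d i i ≡ 0) → (∀ i j → d i j ≡ d j i) →
              sum (λ i → sum λ j → if does (i <? j) then (w i + w j) * d i j else 0)
                ≡ sum (λ i → w i * sum (d i))
  sum-pairs {zero}  w d diag symm = refl
  sum-pairs {suc n} w d diag symm = begin
    -- Comparisons with `zero` compute, so the diagonal entry of the first row and the whole first
    -- column have already vanished.
    sum (λ j → (w₀ + w (suc j)) * d₀ j) + sum pairs
      ≡⟨ cong₂ _+_ (sum-cong-≗ λ j → ℕ.*-distribʳ-+ (d₀ j) w₀ (w (suc j)))
                   (sum-pairs (w ∘ suc) (λ i j → d (suc i) (suc j)) (λ _ → diag _) (λ _ _ → symm _ _)) ⟩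
    sum (λ j → w₀ * d₀ j + w (suc j) * d₀ j) + sum rest
      ≡⟨ cong (_+ sum rest) (∑-distrib-+ (λ j → w₀ * d₀ j) (λ j → w (suc j) * d₀ j)) ⟩
    sum (λ j → w₀ * d₀ j) + sum (λ j → w (suc j) * d₀ j) + sum rest
      ≡⟨ ℕ.+-assoc (sum λ j → w₀ * d₀ j) _ _ ⟩
    sum (λ j → w₀ * d₀ j) + (sum (λ j → w (suc j) * d₀ j) + sum rest)
      -- The zero diagonal entry is put back to complete row `zero`.
      ≡⟨ cong₂ _+_ (trans (sym (*-distribˡ-sum w₀ d₀)) (cong (λ z → w₀ * (z + sum d₀)) (sym (diag zero))))
                   (sym (∑-distrib-+ (λ j → w (suc j) * d₀ j) _)) ⟩
    w₀ * sum (d zero) + sum (λ j → w (suc j) * d₀ j + w (suc j) * sum (d (suc j) ∘ suc))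
      ≡⟨ cong (w₀ * sum (d zero) +_) (sum-cong-≗ λ j →
           trans (cong (λ z → w (suc j) * z + w (suc j) * sum (d (suc j) ∘ suc)) (symm zero (suc j)))
                 (sym (ℕ.*-distribˡ-+ (w (suc j)) _ _))) ⟩
    w₀ * sum (d zero) + sum (λ j → w (suc j) * sum (d (suc j))) ∎
    where
    open ≡-Reasoning
    w₀ = w zero
    d₀ : Fin n → ℕ
    d₀ j = d zero (suc j)
    pairs rest : Fin n → ℕ
    pairs i = sum λ j → if does (suc i <? suc j) then (w (suc i) + w (suc j)) * d (suc i) (suc j) else 0
    rest i = w (suc i) * sum (d (suc i) ∘ suc)

  -- Walks and distances in connected graphs

  -- Opaque because on a symbolic graph dist unfolds into a huge decision tree.
  opaque
    distance : ∀ {n} → Graph n → Fin n → Fin n → ℕ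
    distance = dist

    distance≡dist : ∀ {n} (G : Graph n) i j → distance G i j ≡ dist G i j
    distance≡dist G i j = refl

    schultz-pairs : ∀ {n} (G : Graph n) →
      schultz G ≡ sum (λ i → sum λ j → if does (i <? j) then (degree G i + degree G j) * distance G i j else 0)
    schultz-pairs G = refl

  -- The length bound is what `dist-correct` asks for, since the search behind `dist` is limited by
  -- the number of vertices.
  Connected : ∀ {n} → Graph n → Set
  Connected {n} G = ∀ i j → ∃[ l ] l ≤ n × Walk G i j l

  module _ {n} (G : Graph n) where
    open Graph G

    _++ʷ_ : ∀ {i j k l m} → Walk G i j l → Walk G j k m → Walk G i k (l + m)
    []      ++ʷ v = v
    (a ∷ w) ++ʷ v = a ∷ (w ++ʷ v)

    reverseʷ : ∀ {i j l} → Walk G i j l → Walk G j i l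
    reverseʷ []                  = []
    reverseʷ {l = suc l} (a ∷ w) = subst (Walk G _ _) (ℕ.+-comm l 1) (reverseʷ w ++ʷ (symm a ∷ []))

    IsDistance-unique : ∀ {i j d e} → IsDistance G i j d → IsDistance G i j e → d ≡ e
    IsDistance-unique (w , min) (v , min′) = ℕ.≤-antisym (min _ v) (min′ _ w)

    -- Each edge lowers `f` by at most one, and `f` must come down to 0 at the target. This yields
    -- lower bounds on distances without any analysis of the walks.
    walk-lipschitz : (f : Fin n → ℕ) → (∀ {i j} → Adj i j → f i ≤ suc (f j)) →
                     ∀ {i j l} → f j ≡ 0 → Walk G i j l → f i ≤ l
    walk-lipschitz f lip eq []      = ℕ.≤-reflexive eq
    walk-lipschitz f lip eq (a ∷ w) = ℕ.≤-trans (lip a) (s≤s (walk-lipschitz f lip eq w))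

    module _ (con : Connected G) where

      distance-isDistance : ∀ i j → IsDistance G i j (distance G i j)
      distance-isDistance i j = subst (IsDistance G i j) (sym (distance≡dist G i j)) (dist-correct G i j (con i j))

      distance≤n : ∀ i j → distance G i j ≤ n
      distance≤n i j with con i j
      ... | l , l≤n , w = ℕ.≤-trans (proj₂ (distance-isDistance i j) l w) l≤n

      distance-unique : ∀ {i j d} → IsDistance G i j d → distance G i j ≡ d
      distance-unique = IsDistance-unique (distance-isDistance _ _)

      distance-refl : ∀ i → distance G i i ≡ 0
      distance-refl i = distance-unique ([] , λ _ _ → z≤n)

      distance-sym : ∀ i j → distance G i j ≡ distance G j i
      distance-sym i j with distance-isDistance j i
      ... | w , min = distance-unique (reverseʷ w , λ l v → min l (reverseʷ v))

      distance-lipschitz : ∀ {i j} k → Adj i j → distance G i k ≤ suc (distance G j k)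
      distance-lipschitz {i} {j} k a = proj₂ (distance-isDistance i k) _ (a ∷ proj₁ (distance-isDistance j k))

  module _ {m n} {G : Graph m} {H : Graph n} (f : Fin m → Fin n)
    (hom : ∀ {i j} → Graph.Adj G i j → Graph.Adj H (f i) (f j)) where

    mapʷ : ∀ {i j l} → Walk G i j l → Walk H (f i) (f j) l
    mapʷ []      = []
    mapʷ (a ∷ w) = hom a ∷ mapʷ w

  -- Transmissions and the Schultz index

  transmission : ∀ {n} → Graph n → (Fin n → ℕ) → Fin n → ℕ
  transmission G w v = sum λ y → w y * distance G v y

  totalDegree : ∀ {n} → Graph n → ℕ
  totalDegree G = sum (degree G)

  one : ∀ {n} → Fin n → ℕ
  one _ = 1

  sum-one : ∀ n → sum {n} one ≡ n
  sum-one zero    = refl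
  sum-one (suc n) = cong suc (sum-one n)

  sum-↑ : ∀ n {m} (f : Fin (n + m) → ℕ) → sum f ≡ sum (λ i → f (i ↑ˡ m)) + sum (λ j → f (n ↑ʳ j))
  sum-↑ zero    f = refl
  sum-↑ (suc n) f = trans (cong (f zero +_) (sum-↑ n (f ∘ suc))) (sym (ℕ.+-assoc (f zero) _ _))

  schultz-transmission : ∀ {n} (G : Graph n) → Connected G →
                         schultz G ≡ sum (λ v → degree G v * transmission G one v)
  schultz-transmission G con =
    trans (trans (schultz-pairs G) (sum-pairs (degree G) (distance G) (distance-refl G con) (distance-sym G con)))
          (sum-cong-≗ λ v → cong (degree G v *_) (sum-cong-≗ λ y → sym (ℕ.*-identityˡ (distance G v y))))

  -- The single pentagon

  pentagon-connected : Connected pentagon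
  pentagon-connected i j = dist pentagon i j , table i j
    where
    table : ∀ i j → dist pentagon i j ≤ 5 × Walk pentagon i j (dist pentagon i j)
    table = toWitness {a? = all? λ i → all? λ j →
      dist pentagon i j ℕ.≤? 5 ×-dec walk? pentagon i j (dist pentagon i j)} _

  -- The distance from x₁: 1 on the near pair and 2 on the far pair.
  depth : Fin 5 → ℕ
  depth 0F = 0
  depth 1F = 1
  depth 2F = 2
  depth 3F = 2
  depth 4F = 1

  opaque
    unfolding distance

    distance-pentagon-0F : ∀ a → distance pentagon a 0F ≡ depth a
    distance-pentagon-0F = toWitness {a? = all? λ a → dist pentagon a 0F ℕ.≟ depth a} _

    -- The strict bound leaves room for the bridge edge in `dist⊎≤5+m`.
    distance-pentagon<5 : ∀ a b → suc (distance pentagon a b) ≤ 5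
    distance-pentagon<5 = toWitness {a? = all? λ a → all? λ b → suc (dist pentagon a b) ℕ.≤? 5} _

    transmission-pentagon : ∀ b → transmission pentagon one b ≡ 6
    transmission-pentagon = toWitness {a? = all? λ b → transmission pentagon one b ℕ.≟ 6} _

    -- The weights are the degrees of the new vertices once attached: 2, and one more at x₁. Hence
    -- twice the transmission 6, plus the distance to x₁.
    transmission-pentagon-degree : ∀ b →
      transmission pentagon (λ a → 2 + indicator (a ≟ 0F)) b ≡ 12 + depth b
    transmission-pentagon-degree = toWitness {a? = all? λ b →
      transmission pentagon (λ a → 2 + indicator (a ≟ 0F)) b ℕ.≟ 12 + depth b} _

  -- Attaching a pentagon by a bridge

  module _ {m} (G : Graph m) (con : Connected G) (u : Fin m) where
    private
      module G = Graph G
      G⁺ = addPentagon G u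

    -- The candidate for the distance in `G⁺`. A walk between the two sides has to use the bridge
    -- from x₁ to `u`, which accounts for the `suc` in the mixed cases.
    dist⊎ : Fin 5 ⊎ Fin m → Fin 5 ⊎ Fin m → ℕ
    dist⊎ (inj₁ a) (inj₁ b) = distance pentagon a b
    dist⊎ (inj₁ a) (inj₂ y) = distance pentagon a 0F + suc (distance G u y)
    dist⊎ (inj₂ x) (inj₁ b) = distance G x u + suc (distance pentagon 0F b)
    dist⊎ (inj₂ x) (inj₂ y) = distance G x y

    dist⊎-refl : ∀ p → dist⊎ p p ≡ 0
    dist⊎-refl (inj₁ a) = distance-refl pentagon pentagon-connected a
    dist⊎-refl (inj₂ x) = distance-refl G con x

    -- An edge inside one side changes only the summand belonging to that side. The bridge lowers
    -- the value by exactly one when crossed towards `r` and raises it when crossed away from `r`.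
    dist⊎-lipschitz : ∀ p q r → Adj⊎ G u p q → dist⊎ p r ≤ suc (dist⊎ q r)
    dist⊎-lipschitz (inj₁ a) (inj₁ b) (inj₁ c) e = distance-lipschitz pentagon pentagon-connected {a} {b} c e
    dist⊎-lipschitz (inj₁ a) (inj₁ b) (inj₂ z) e =
      ℕ.+-monoˡ-≤ (suc (distance G u z)) (distance-lipschitz pentagon pentagon-connected {a} {b} 0F e)
    dist⊎-lipschitz (inj₁ a) (inj₂ y) (inj₁ c) (refl , refl) =
      ℕ.m≤n⇒m≤1+n (ℕ.≤-trans (ℕ.n≤1+n _) (ℕ.m≤n+m _ (distance G u u)))
    dist⊎-lipschitz (inj₁ a) (inj₂ y) (inj₂ z) (refl , refl) =
      ℕ.≤-reflexive (cong (_+ suc (distance G u z)) (distance-refl pentagon pentagon-connected 0F))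
    dist⊎-lipschitz (inj₂ x) (inj₁ b) (inj₁ c) (refl , refl) =
      ℕ.≤-reflexive (cong (_+ suc (distance pentagon 0F c)) (distance-refl G con u))
    dist⊎-lipschitz (inj₂ x) (inj₁ b) (inj₂ z) (refl , refl) =
      ℕ.m≤n⇒m≤1+n (ℕ.≤-trans (ℕ.n≤1+n _) (ℕ.m≤n+m _ (distance pentagon 0F 0F)))
    dist⊎-lipschitz (inj₂ x) (inj₂ y) (inj₁ c) e =
      ℕ.+-monoˡ-≤ (suc (distance pentagon 0F c)) (distance-lipschitz G con u e)
    dist⊎-lipschitz (inj₂ x) (inj₂ y) (inj₂ z) e = distance-lipschitz G con z e

    inl : Fin 5 → Fin (5 + m)
    inl = _↑ˡ m

    inr : Fin m → Fin (5 + m)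
    inr = 5 ↑ʳ_

    walk-inl : ∀ a b {l} → Walk pentagon a b l → Walk G⁺ (inl a) (inl b) l
    walk-inl a b = mapʷ {H = G⁺} inl λ {i} {j} →
      subst₂ (Adj⊎ G u) (sym (splitAt-↑ˡ 5 i m)) (sym (splitAt-↑ˡ 5 j m))

    walk-inr : ∀ {x y l} → Walk G x y l → Walk G⁺ (inr x) (inr y) l
    walk-inr = mapʷ {H = G⁺} inr id

    -- In the mixed cases, shortest walks to and from the ends of the bridge are joined by the
    -- bridge edge `(refl , refl)`.
    walk⊎ : ∀ p q → Walk G⁺ (join 5 m p) (join 5 m q) (dist⊎ p q)
    walk⊎ (inj₁ a) (inj₁ b) = walk-inl a b (proj₁ (distance-isDistance pentagon pentagon-connected a b))
    walk⊎ (inj₁ a) (inj₂ y) = _++ʷ_ G⁺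
      (walk-inl a 0F (proj₁ (distance-isDistance pentagon pentagon-connected a 0F)))
      ((refl , refl) ∷ walk-inr (proj₁ (distance-isDistance G con u y)))
    walk⊎ (inj₂ x) (inj₁ b) = _++ʷ_ G⁺
      (walk-inr (proj₁ (distance-isDistance G con x u)))
      ((refl , refl) ∷ walk-inl 0F b (proj₁ (distance-isDistance pentagon pentagon-connected 0F b)))
    walk⊎ (inj₂ x) (inj₂ y) = walk-inr (proj₁ (distance-isDistance G con x y))

    dist⊎≤5+m : ∀ p q → dist⊎ p q ≤ 5 + m
    dist⊎≤5+m (inj₁ a) (inj₁ b) = ℕ.≤-trans (distance≤n pentagon pentagon-connected a b) (ℕ.m≤m+n 5 m)
    dist⊎≤5+m (inj₁ a) (inj₂ y) =
      ℕ.≤-trans (ℕ.≤-reflexive (ℕ.+-suc (distance pentagon a 0F) (distance G u y)))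
                (ℕ.+-mono-≤ (distance-pentagon<5 a 0F) (distance≤n G con u y))
    dist⊎≤5+m (inj₂ x) (inj₁ b) =
      ℕ.≤-trans (ℕ.≤-reflexive (ℕ.+-comm (distance G x u) _))
                (ℕ.+-mono-≤ (distance-pentagon<5 0F b) (distance≤n G con x u))
    dist⊎≤5+m (inj₂ x) (inj₂ y) = ℕ.≤-trans (distance≤n G con x y) (ℕ.m≤n+m m 5)

    -- `walk⊎` attains the value; `walk-lipschitz`, applied with the target `j` fixed, rules out
    -- shorter walks.
    dist⊎-isDistance : ∀ i j → IsDistance G⁺ i j (dist⊎ (splitAt 5 i) (splitAt 5 j))
    dist⊎-isDistance i j =
      subst₂ (λ i′ j′ → Walk G⁺ i′ j′ (dist⊎ (splitAt 5 i) (splitAt 5 j))) (join-splitAt 5 m i) (join-splitAt 5 m j)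
        (walk⊎ (splitAt 5 i) (splitAt 5 j)) ,
      λ l → walk-lipschitz G⁺ (λ k → dist⊎ (splitAt 5 k) (splitAt 5 j))
              (λ {k} {k′} → dist⊎-lipschitz (splitAt 5 k) (splitAt 5 k′) (splitAt 5 j))
              (dist⊎-refl (splitAt 5 j))

    addPentagon-connected : Connected G⁺
    addPentagon-connected i j = _ , dist⊎≤5+m (splitAt 5 i) (splitAt 5 j) , proj₁ (dist⊎-isDistance i j)

    distance-addPentagon : ∀ i j → distance G⁺ i j ≡ dist⊎ (splitAt 5 i) (splitAt 5 j)
    distance-addPentagon i j = distance-unique G⁺ addPentagon-connected (dist⊎-isDistance i j)

    degree-new : ∀ a → degree G⁺ (inl a) ≡ 2 + indicator (a ≟ 0F)
    -- The count over the five new vertices computes to 2. The rest of it runs over the old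
    -- vertices, among which x₁ is adjacent to `u` alone.
    degree-new 0F = cong (2 +_) (trans (count-tabulate (Graph.adj? G⁺ 0F) inr) (sum-indicator u))
    degree-new 1F = cong (2 +_) (trans (count-tabulate (Graph.adj? G⁺ 1F) inr) (sum-zero {m} _ λ _ → refl))
    degree-new 2F = cong (2 +_) (trans (count-tabulate (Graph.adj? G⁺ 2F) inr) (sum-zero {m} _ λ _ → refl))
    degree-new 3F = cong (2 +_) (trans (count-tabulate (Graph.adj? G⁺ 3F) inr) (sum-zero {m} _ λ _ → refl))
    degree-new 4F = cong (2 +_) (trans (count-tabulate (Graph.adj? G⁺ 4F) inr) (sum-zero {m} _ λ _ → refl))

    degree-old : ∀ x → degree G⁺ (inr x) ≡ indicator (x ≟ u) + degree G x
    degree-old x = trans (count-tabulate (Graph.adj? G⁺ (inr x)) id)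
      -- Among the five new vertices only x₁ can be adjacent to `x`, and the tests for the other
      -- four compute to 0.
      (cong (indicator (x ≟ u) +_) (sym (count-tabulate (G.adj? x) id)))

    distance-inl-inl : ∀ a b → distance G⁺ (inl a) (inl b) ≡ distance pentagon a b
    distance-inl-inl a b = trans (distance-addPentagon (inl a) (inl b))
      (cong₂ dist⊎ (splitAt-↑ˡ 5 a m) (splitAt-↑ˡ 5 b m))

    distance-inl-inr : ∀ a y → distance G⁺ (inl a) (inr y) ≡ suc (depth a) + distance G u y
    distance-inl-inr a y = trans (distance-addPentagon (inl a) (inr y))
      (trans (cong (λ p → dist⊎ p (inj₂ y)) (splitAt-↑ˡ 5 a m))
        (trans (ℕ.+-suc (distance pentagon a 0F) _) (cong (λ d → suc d + distance G u y) (distance-pentagon-0F a))))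

    -- Every old vertex is reached through `u`, which is `suc (depth b)` steps away. That detour is
    -- paid once per unit of old weight. The weight stays general so that both `one` and `degree G⁺`
    -- can be inserted.
    transmission-new : ∀ w b → transmission G⁺ w (inl b) ≡
      transmission pentagon (w ∘ inl) b + (sum (w ∘ inr) * suc (depth b) + transmission G (w ∘ inr) u)
    transmission-new w b = begin
      sum (λ i → w i * distance G⁺ (inl b) i)
        ≡⟨ sum-↑ 5 (λ i → w i * distance G⁺ (inl b) i) ⟩
      sum (λ a → w (inl a) * distance G⁺ (inl b) (inl a)) + sum (λ y → w (inr y) * distance G⁺ (inl b) (inr y))
        ≡⟨ cong₂ _+_ (sum-cong-≗ λ a → cong (w (inl a) *_) (distance-inl-inl b a))
                     (sum-cong-≗ λ y → trans (cong (w (inr y) *_) (distance-inl-inr b y))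
                                             (ℕ.*-distribˡ-+ (w (inr y)) (suc (depth b)) (distance G u y))) ⟩
      near + sum (λ y → w (inr y) * suc (depth b) + w (inr y) * distance G u y)
        ≡⟨ cong (near +_) (∑-distrib-+ (λ y → w (inr y) * suc (depth b)) (λ y → w (inr y) * distance G u y)) ⟩
      near + (sum (λ y → w (inr y) * suc (depth b)) + transmission G (w ∘ inr) u)
        ≡⟨ cong (λ z → near + (z + transmission G (w ∘ inr) u)) (sym (*-distribʳ-sum (suc (depth b)) (w ∘ inr))) ⟩
      near + (sum (w ∘ inr) * suc (depth b) + transmission G (w ∘ inr) u) ∎
      where
      open ≡-Reasoning
      near = transmission pentagon (w ∘ inl) b

    transmission-old : ∀ x → transmission G⁺ one (inr x) ≡ 5 * distance G x u + 11 + transmission G one x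
    transmission-old x = begin
      transmission G⁺ one (inr x)
        ≡⟨ sum-↑ 5 (λ i → 1 * distance G⁺ (inr x) i) ⟩
      sum (λ a → 1 * distance G⁺ (inr x) (inl a)) + sum (λ y → 1 * distance G⁺ (inr x) (inr y))
        ≡⟨ cong₂ _+_ (sum-cong-≗ λ a → cong (1 *_)
                       (trans (distance-sym G⁺ addPentagon-connected (inr x) (inl a))
                         (trans (distance-inl-inr a x) (cong (suc (depth a) +_) (distance-sym G con u x)))))
                     (sum-cong-≗ λ y → cong (1 *_) (distance-addPentagon (inr x) (inr y))) ⟩
      sum (λ a → 1 * (suc (depth a) + distance G x u)) + transmission G one x
        -- 11 = 1 + 2 + 3 + 3 + 2 adds up the distances from `u` to the new vertices.
        ≡⟨ cong (_+ transmission G one x) (lemma (distance G x u)) ⟩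
      5 * distance G x u + 11 + transmission G one x ∎
      where
      open ≡-Reasoning
      lemma : ∀ d → 1 * (1 + d) + (1 * (2 + d) + (1 * (3 + d) + (1 * (3 + d) + (1 * (2 + d) + 0)))) ≡ 5 * d + 11
      lemma = solve-∀

    -- The bridge raises the degree of `u` by one and changes no other old degree.
    sum-degree-old : ∀ f → sum (λ x → degree G⁺ (inr x) * f x) ≡ f u + sum (λ x → degree G x * f x)
    sum-degree-old f = begin
      sum (λ x → degree G⁺ (inr x) * f x)
        ≡⟨ sum-cong-≗ (λ x → trans (cong (_* f x) (degree-old x))
                                     (ℕ.*-distribʳ-+ (f x) (indicator (x ≟ u)) (degree G x))) ⟩
      sum (λ x → indicator (x ≟ u) * f x + degree G x * f x)
        ≡⟨ ∑-distrib-+ (λ x → indicator (x ≟ u) * f x) (λ x → degree G x * f x) ⟩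
      sum (λ x → indicator (x ≟ u) * f x) + sum (λ x → degree G x * f x)
        ≡⟨ cong (_+ sum (λ x → degree G x * f x)) (sum-point u f) ⟩
      f u + sum (λ x → degree G x * f x) ∎
      where open ≡-Reasoning

    totalDegree-old : sum (degree G⁺ ∘ inr) ≡ suc (totalDegree G)
    totalDegree-old = begin
      sum (degree G⁺ ∘ inr)                ≡⟨ sum-cong-≗ (λ x → sym (ℕ.*-identityʳ (degree G⁺ (inr x)))) ⟩
      sum (λ x → degree G⁺ (inr x) * 1)    ≡⟨ sum-degree-old one ⟩
      suc (sum (λ x → degree G x * 1))     ≡⟨ cong suc (sum-cong-≗ λ x → ℕ.*-identityʳ (degree G x)) ⟩
      suc (totalDegree G)                  ∎
      where open ≡-Reasoning

    -- Twice the six new edges: five of the pentagon and the bridge.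
    totalDegree-addPentagon : totalDegree G⁺ ≡ 12 + totalDegree G
    totalDegree-addPentagon = begin
      sum (degree G⁺)                                ≡⟨ sum-↑ 5 (degree G⁺) ⟩
      sum (degree G⁺ ∘ inl) + sum (degree G⁺ ∘ inr)  ≡⟨ cong₂ _+_ (sum-cong-≗ degree-new) totalDegree-old ⟩
      12 + totalDegree G                             ∎
      where open ≡-Reasoning

    transmission-one-new : ∀ b → transmission G⁺ one (inl b) ≡ 6 + (m * suc (depth b) + transmission G one u)
    transmission-one-new b = trans (transmission-new one b)
      (cong₂ (λ s n → s + (n * suc (depth b) + transmission G one u))
        (transmission-pentagon b) (sum-one m))

    transmission-degree-new : ∀ b → transmission G⁺ (degree G⁺) (inl b) ≡
      12 + depth b + (suc (totalDegree G) * suc (depth b) + transmission G (degree G) u)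
    transmission-degree-new b = trans (transmission-new (degree G⁺) b) (cong₂ _+_
      (trans (sum-cong-≗ λ a → cong (_* distance pentagon b a) (degree-new a))
             (transmission-pentagon-degree b))
      (cong₂ _+_ (cong (_* suc (depth b)) totalDegree-old)
        -- The extra degree of `u` is multiplied by the distance from `u` to itself, so it drops
        -- out.
        (trans (sum-degree-old (distance G u)) (cong (_+ transmission G (degree G) u) (distance-refl G con u)))))

    schultz-addPentagon : schultz G⁺ ≡ 77 + 23 * m + 11 * totalDegree G
      + (12 * transmission G one u + 5 * transmission G (degree G) u) + schultz G
    schultz-addPentagon = begin
      schultz G⁺
        ≡⟨ schultz-transmission G⁺ addPentagon-connected ⟩
      sum (λ v → degree G⁺ v * T⁺ v)
        ≡⟨ sum-↑ 5 (λ v → degree G⁺ v * T⁺ v) ⟩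
      sum (λ a → degree G⁺ (inl a) * T⁺ (inl a)) + sum (λ x → degree G⁺ (inr x) * T⁺ (inr x))
        -- On the old side the raised degree of `u` counts the new transmission of `u` once more;
        -- this is `11 + T u`, as `u` has distance 0 from itself.
        ≡⟨ cong₂ _+_ (sum-cong-≗ λ a → cong₂ _*_ (degree-new a) (transmission-one-new a))
                     (trans (sum-cong-≗ λ x → cong (degree G⁺ (inr x) *_) (transmission-old x))
                            (sum-degree-old λ x → 5 * distance G x u + 11 + T x)) ⟩
      sum (λ a → (2 + indicator (a ≟ 0F)) * (6 + (m * suc (depth a) + T u)))
        + (5 * distance G u u + 11 + T u + sum (λ x → degree G x * (5 * distance G x u + 11 + T x)))
        ≡⟨ cong₂ _+_ (new-side m (T u)) (cong₂ (λ d s → 5 * d + 11 + T u + s) (distance-refl G con u) old-side) ⟩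
      66 + 23 * m + 11 * T u + (11 + T u + (5 * transmission G (degree G) u + 11 * totalDegree G + schultz G))
        ≡⟨ collect m (totalDegree G) (T u) (transmission G (degree G) u) (schultz G) ⟩
      77 + 23 * m + 11 * totalDegree G + (12 * T u + 5 * transmission G (degree G) u) + schultz G ∎
      where
      open ≡-Reasoning
      T⁺ : Fin (5 + m) → ℕ
      T⁺ = transmission G⁺ one
      T : Fin m → ℕ
      T = transmission G one
      -- The degrees 3, 2, 2, 2, 2 add up to 11, giving 66 = 11 * 6 and `11 * t`. Weighted by the
      -- distances 1, 2, 3, 3, 2 to `u` they add up to 23.
      new-side : ∀ m t → 3 * (6 + (m * 1 + t)) + (2 * (6 + (m * 2 + t)) + (2 * (6 + (m * 3 + t))
        + (2 * (6 + (m * 3 + t)) + (2 * (6 + (m * 2 + t)) + 0)))) ≡ 66 + 23 * m + 11 * t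
      new-side = solve-∀
      collect : ∀ m d t t′ s → 66 + 23 * m + 11 * t + (11 + t + (5 * t′ + 11 * d + s))
        ≡ 77 + 23 * m + 11 * d + (12 * t + 5 * t′) + s
      collect = solve-∀
      expand : ∀ w d t → w * (5 * d + 11 + t) ≡ 5 * (w * d) + 11 * w + w * t
      expand = solve-∀
      old-side : sum (λ x → degree G x * (5 * distance G x u + 11 + T x))
        ≡ 5 * transmission G (degree G) u + 11 * totalDegree G + schultz G
      old-side = begin
        sum (λ x → degree G x * (5 * distance G x u + 11 + T x))
          ≡⟨ sum-cong-≗ (λ x → trans (expand (degree G x) (distance G x u) (T x))
               (cong (λ d → 5 * (degree G x * d) + 11 * degree G x + degree G x * T x) (distance-sym G con x u))) ⟩
        sum (λ x → 5 * (degree G x * distance G u x) + 11 * degree G x + degree G x * T x)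
          ≡⟨ ∑-distrib-+ (λ x → 5 * (degree G x * distance G u x) + 11 * degree G x) (λ x → degree G x * T x) ⟩
        sum (λ x → 5 * (degree G x * distance G u x) + 11 * degree G x) + sum (λ x → degree G x * T x)
          ≡⟨ cong₂ _+_ (∑-distrib-+ (λ x → 5 * (degree G x * distance G u x)) (λ x → 11 * degree G x))
                       (sym (schultz-transmission G con)) ⟩
        sum (λ x → 5 * (degree G x * distance G u x)) + sum (λ x → 11 * degree G x) + schultz G
          ≡⟨ cong (_+ schultz G) (cong₂ _+_ (sym (*-distribˡ-sum 5 λ x → degree G x * distance G u x))
                                            (sym (*-distribˡ-sum 11 (degree G)))) ⟩
        5 * transmission G (degree G) u + 11 * totalDegree G + schultz G ∎

  -- Recurrences along the chain

  PG-connected : ∀ {k} (us : Vec (Fin 5) k) → Connected (PG us)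
  PG-connected []       = pentagon-connected
  PG-connected (u ∷ us) = addPentagon-connected (PG us) (PG-connected us) (u ↑ˡ _)

  totalDegree-PG : ∀ {k} (us : Vec (Fin 5) k) → totalDegree (PG us) ≡ 10 + k * 12
  totalDegree-PG []               = refl
  totalDegree-PG {suc k} (u ∷ us) =
    trans (totalDegree-addPentagon (PG us) (PG-connected us) (u ↑ˡ k * 5))
      (trans (cong (12 +_) (totalDegree-PG us)) (lemma k))
    where
    lemma : ∀ k → 12 + (10 + k * 12) ≡ 10 + (1 + k) * 12
    lemma = solve-∀

  -- The part of the increment of the Schultz index, when a pentagon is attached
  -- at u, that depends on the shape of the chain.
  attachmentCost : ∀ {k} → Vec (Fin 5) k → Fin 5 → ℕ
  attachmentCost {k} us u =
    12 * transmission (PG us) one (u ↑ˡ k * 5) + 5 * transmission (PG us) (degree (PG us)) (u ↑ˡ k * 5)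

  opaque
    unfolding distance

    -- 12 * 6 + 5 * 12: each vertex has transmission 6 and all degrees are 2.
    attachmentCost-[] : ∀ u → attachmentCost [] u ≡ 132
    attachmentCost-[] = toWitness {a? = all? λ u → attachmentCost [] u ℕ.≟ 132} _

  -- Both transmissions of `v` refer back to those of the previous attaching vertex `u`, so the
  -- recurrence closes. The constant part 132 + 5 * `depth v` is rewritten as 127 + 5 *
  -- `suc (depth v)`; the total coefficient of `suc (depth v)` is then 5 + 60 (k + 1) + 5 (11 + 12
  -- k) = 120 (k + 1).
  attachmentCost-∷ : ∀ {k} (us : Vec (Fin 5) k) u v →
    attachmentCost (u ∷ us) v ≡ 127 + suc (depth v) * (120 * suc k) + attachmentCost us u
  attachmentCost-∷ {k} us u v = begin
    attachmentCost (u ∷ us) v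
      ≡⟨ cong₂ (λ s t → 12 * s + 5 * t) (transmission-one-new G con u′ v)
           (trans (transmission-degree-new G con u′ v)
                  (cong (λ d → 12 + depth v + (suc d * suc (depth v) + t₂)) (totalDegree-PG us))) ⟩
    12 * (6 + (suc k * 5 * suc (depth v) + t₁)) + 5 * (12 + depth v + ((11 + k * 12) * suc (depth v) + t₂))
      ≡⟨ lemma k (depth v) t₁ t₂ ⟩
    127 + suc (depth v) * (120 * suc k) + attachmentCost us u ∎
    where
    open ≡-Reasoning
    G = PG us
    con = PG-connected us
    u′ = u ↑ˡ k * 5
    t₁ = transmission G one u′
    t₂ = transmission G (degree G) u′
    lemma : ∀ k d t₁ t₂ →
      12 * (6 + ((1 + k) * 5 * (1 + d) + t₁)) + 5 * (12 + d + ((11 + k * 12) * (1 + d) + t₂))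
        ≡ 127 + (1 + d) * (120 * (1 + k)) + (12 * t₁ + 5 * t₂)
    lemma = solve-∀

  -- `PG us` has n = k + 1 pentagons, so 302 + 247 k is 55 + 247 n.
  schultz-PG-∷ : ∀ {k} (us : Vec (Fin 5) k) u →
    schultz (PG (u ∷ us)) ≡ 302 + 247 * k + attachmentCost us u + schultz (PG us)
  schultz-PG-∷ {k} us u =
    trans (schultz-addPentagon (PG us) (PG-connected us) (u ↑ˡ k * 5))
          (cong (λ c → c + attachmentCost us u + schultz (PG us))
            (trans (cong (λ d → 77 + 23 * (suc k * 5) + 11 * d) (totalDegree-PG us)) (lemma k)))
    where
    lemma : ∀ k → 77 + 23 * ((1 + k) * 5) + 11 * (10 + k * 12) ≡ 302 + 247 * k
    lemma = solve-∀

open PentagonalChains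
  using (depth; attachmentCost; attachmentCost-[]; attachmentCost-∷; schultz-PG-∷)

-- The cost of the latest attachment as a random variable on whole histories, the form to which `𝔼`
-- applies.
cost : ∀ {k} → Vec (Fin 5) (suc k) → ℕ
cost (u ∷ us) = attachmentCost us u

-- Scalars and sums over histories

module Expectation {c ℓ₁ ℓ₂} (R : OrderedCommutativeRing c ℓ₁ ℓ₂) where
  open OrderedCommutativeRing R
  open Random R
  open SemiringSum semiring hiding (sum)
  open SemiringMult semiring using (×-homo-+; ×1-homo-*)
  open RingProperties ring using (-‿distribˡ-*; -‿+-comm)
  open NaturalCoefficients commutativeSemiring
    using (Polynomial; solve; con; _:+_; _:*_; _:=_)
  open SetoidReasoning setoid

  fromℕ-+ : ∀ a b → fromℕ (a ℕ.+ b) ≈ fromℕ a + fromℕ b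
  fromℕ-+ = ×-homo-+ 1#

  fromℕ-* : ∀ a b → fromℕ (a ℕ.* b) ≈ fromℕ a * fromℕ b
  fromℕ-* = ×1-homo-*

  -- Denotes fromℕ c definitionally, which con c does not.
  num : ∀ {n} → ℕ → Polynomial n
  num zero    = con 0
  num (suc c) = con 1 :+ num c

  -- Brings back the negative terms at the very end. The solver has natural coefficients only, so
  -- identities are first proved without subtraction; here `- b` and `- c` enter it as atoms.
  subtract : ∀ {s a b c e} t → s + (b * t + c) ≈ a * t + e → s ≈ (a - b) * t + e - c
  subtract {s} {a} {b} {c} {e} t eq = begin
    s                                    ≈⟨ +-identityʳ s ⟨
    s + 0#                               ≈⟨ +-congˡ (-‿inverseʳ (b * t + c)) ⟨
    s + ((b * t + c) - (b * t + c))      ≈⟨ +-assoc s _ _ ⟨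
    s + (b * t + c) - (b * t + c)        ≈⟨ +-cong eq (sym (-‿+-comm (b * t) c)) ⟩
    a * t + e + (- (b * t) - c)          ≈⟨ +-congˡ (+-congʳ (-‿distribˡ-* b t)) ⟩
    a * t + e + (- b * t - c)            ≈⟨ solve 5 (λ a e b c t → a :* t :+ e :+ (b :* t :+ c) := (a :+ b) :* t :+ e :+ c)
                                              refl a e (- b) (- c) t ⟩
    (a - b) * t + e - c                  ∎

  sumVec-cong : ∀ k {f g : Vec (Fin 5) k → Carrier} → (∀ us → f us ≈ g us) → sumVec k f ≈ sumVec k g
  sumVec-cong zero    f≈g = f≈g []
  sumVec-cong (suc k) f≈g = sum-cong-≋ λ u → sumVec-cong k λ us → f≈g (u ∷ us)

  sumVec-+ : ∀ k (f g : Vec (Fin 5) k → Carrier) → sumVec k (λ us → f us + g us) ≈ sumVec k f + sumVec k g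
  sumVec-+ zero    f g = refl
  sumVec-+ (suc k) f g = trans (sum-cong-≋ λ u → sumVec-+ k (f ∘ (u ∷_)) (g ∘ (u ∷_)))
    (∑-distrib-+ (λ u → sumVec k (f ∘ (u ∷_))) (λ u → sumVec k (g ∘ (u ∷_))))

  sumVec-*ʳ : ∀ k (f : Vec (Fin 5) k → Carrier) a → sumVec k (λ us → f us * a) ≈ sumVec k f * a
  sumVec-*ʳ zero    f a = refl
  sumVec-*ʳ (suc k) f a = trans (sum-cong-≋ λ u → sumVec-*ʳ k (f ∘ (u ∷_)) a)
    (sym (*-distribʳ-sum a (λ u → sumVec k (f ∘ (u ∷_)))))

  -- `sumVec` has the newest vertex outermost, while conditioning on the past needs it innermost.
  sum-sumVec : ∀ k {n} (f : Fin n → Vec (Fin 5) k → Carrier) →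
               sum (λ u → sumVec k (f u)) ≈ sumVec k (λ us → sum λ u → f u us)
  sum-sumVec zero    f = refl
  sum-sumVec (suc k) f = trans (∑-comm λ u v → sumVec k (f u ∘ (v ∷_)))
    (sum-cong-≋ λ v → sum-sumVec k λ u us → f u (v ∷ us))

  -- Expectation, conditioning and the averaged recurrences

  module _ {p₁ : Carrier} (law : AttachmentLaw p₁) where
    open AttachmentLaw law

    p₁+p₂≈1 : p₁ + p₂ ≈ 1#
    p₁+p₂≈1 = begin
      p₁ + (1# - p₁)  ≈⟨ solve 3 (λ p o q → p :+ (o :+ q) := o :+ (p :+ q)) refl p₁ 1# (- p₁) ⟩
      1# + (p₁ - p₁)  ≈⟨ +-congˡ (-‿inverseʳ p₁) ⟩
      1# + 0#         ≈⟨ +-identityʳ 1# ⟩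
      1#              ∎

    -- `depth` is constant on the near pair and on the far pair, so only the prescribed totals of
    -- the two pairs enter.
    sum-weight-* : ∀ {k} (us : Vec (Fin 5) (suc k)) (f : ℕ → Carrier) →
      sum (λ u → weight us u * f (depth u)) ≈ p₁ * f 1 + p₂ * f 2
    sum-weight-* us f = begin
      sum (λ u → weight us u * f (depth u))
        ≈⟨ solve 8 (λ w₀ w₁ w₂ w₃ w₄ f₀ f₁ f₂ →
             w₀ :* f₀ :+ (w₁ :* f₁ :+ (w₂ :* f₂ :+ (w₃ :* f₂ :+ (w₄ :* f₁ :+ con 0))))
               := w₀ :* f₀ :+ ((w₁ :+ w₄) :* f₁ :+ (w₂ :+ w₃) :* f₂))
             refl (weight us 0F) (weight us 1F) (weight us 2F) (weight us 3F) (weight us 4F) (f 0) (f 1) (f 2) ⟩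
      weight us 0F * f 0 + ((weight us 1F + weight us 4F) * f 1 + (weight us 2F + weight us 3F) * f 2)
        ≈⟨ +-cong (trans (*-congʳ (not-x₁ us)) (zeroˡ (f 0))) (+-cong (*-congʳ (near us)) (*-congʳ (far us))) ⟩
      0# + (p₁ * f 1 + p₂ * f 2)
        ≈⟨ +-identityˡ _ ⟩
      p₁ * f 1 + p₂ * f 2 ∎

    sum-weight : ∀ {k} (us : Vec (Fin 5) k) → sum (weight us) ≈ 1#
    sum-weight []         = first
    sum-weight us@(_ ∷ _) = begin
      sum (weight us)                ≈⟨ sum-cong-≋ (λ u → sym (*-identityʳ (weight us u))) ⟩
      sum (λ u → weight us u * 1#)   ≈⟨ sum-weight-* us (λ _ → 1#) ⟩
      p₁ * 1# + p₂ * 1#              ≈⟨ +-cong (*-identityʳ p₁) (*-identityʳ p₂) ⟩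
      p₁ + p₂                        ≈⟨ p₁+p₂≈1 ⟩
      1#                             ∎

    𝔼-cong : ∀ {k} (X Y : Vec (Fin 5) k → Carrier) → (∀ us → X us ≈ Y us) → 𝔼 law X ≈ 𝔼 law Y
    𝔼-cong {k} X Y X≈Y = sumVec-cong k λ us → *-congˡ (X≈Y us)

    𝔼-+ : ∀ {k} (X Y : Vec (Fin 5) k → Carrier) → 𝔼 law (λ us → X us + Y us) ≈ 𝔼 law X + 𝔼 law Y
    𝔼-+ {k} X Y = trans (sumVec-cong k λ us → distribˡ (probability law us) (X us) (Y us)) (sumVec-+ k _ _)

    𝔼-*ʳ : ∀ {k} (X : Vec (Fin 5) k → Carrier) a → 𝔼 law (λ us → X us * a) ≈ 𝔼 law X * a
    𝔼-*ʳ {k} X a = trans (sumVec-cong k λ us → sym (*-assoc (probability law us) (X us) a)) (sumVec-*ʳ k _ a)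

    -- The tower property: average over the newest vertex given the past, then over the past.
    𝔼-condition : ∀ {k} (X : Vec (Fin 5) (suc k) → Carrier) →
                  𝔼 law X ≈ 𝔼 law (λ us → sum λ u → weight us u * X (u ∷ us))
    𝔼-condition {k} X = begin
      sum (λ u → sumVec k λ us → probability law us * weight us u * X (u ∷ us))
        ≈⟨ sum-sumVec k (λ u us → probability law us * weight us u * X (u ∷ us)) ⟩
      sumVec k (λ us → sum λ u → probability law us * weight us u * X (u ∷ us))
        ≈⟨ sumVec-cong k (λ us → trans
             (sum-cong-≋ λ u → *-assoc (probability law us) (weight us u) (X (u ∷ us)))
             (sym (*-distribˡ-sum (probability law us) λ u → weight us u * X (u ∷ us)))) ⟩
      sumVec k (λ us → probability law us * sum λ u → weight us u * X (u ∷ us)) ∎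

    𝔼-tail : ∀ {k} (X : Vec (Fin 5) k → Carrier) → 𝔼 law (X ∘ tail) ≈ 𝔼 law X
    𝔼-tail X = trans (𝔼-condition (X ∘ tail)) (𝔼-cong _ X λ us → begin
      sum (λ u → weight us u * X us)  ≈⟨ *-distribʳ-sum (X us) (weight us) ⟨
      sum (weight us) * X us          ≈⟨ *-congʳ (sum-weight us) ⟩
      1# * X us                       ≈⟨ *-identityˡ (X us) ⟩
      X us                            ∎)

    𝔼-const : ∀ k a → 𝔼 law {k} (λ _ → a) ≈ a
    𝔼-const zero    a = *-identityˡ a
    𝔼-const (suc k) a = trans (𝔼-tail {k} λ _ → a) (𝔼-const k a)

    meanStep : Carrier
    meanStep = p₁ * fromℕ 2 + p₂ * fromℕ 3

    -- The value 3 - p₁ of the conditional mean of δ + 1, in subtraction-free form.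
    meanStep+p₁≈3 : meanStep + p₁ ≈ fromℕ 3
    meanStep+p₁≈3 = begin
      p₁ * fromℕ 2 + p₂ * fromℕ 3 + p₁
        ≈⟨ solve 2 (λ p q → p :* num 2 :+ q :* num 3 :+ p := (p :+ q) :* num 3) refl p₁ p₂ ⟩
      (p₁ + p₂) * fromℕ 3   ≈⟨ *-congʳ p₁+p₂≈1 ⟩
      1# * fromℕ 3          ≈⟨ *-identityˡ (fromℕ 3) ⟩
      fromℕ 3               ∎

    -- The near and far probabilities are prescribed from the second attachment on, hence the length
    -- at least two. The conditional mean is the same for every history.
    𝔼-head : ∀ k → 𝔼 law {suc (suc k)} (λ us → fromℕ (suc (depth (head us)))) ≈ meanStep
    𝔼-head k = trans (𝔼-condition {suc k} λ us → fromℕ (suc (depth (head us))))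
      (trans (𝔼-cong {suc k} _ (λ _ → meanStep) λ us → sum-weight-* us (fromℕ ∘ suc)) (𝔼-const (suc k) meanStep))

    -- The initial value 132 plus the mean increments 127 + 120 j `meanStep` for j = 1, ..., k,
    -- using 120 (1 + ... + k) = 60 k (k + 1).
    𝔼-cost : ∀ k → 𝔼 law {suc k} (fromℕ ∘ cost)
      ≈ fromℕ 132 + fromℕ 127 * fromℕ k + fromℕ 60 * (fromℕ k * fromℕ (suc k)) * meanStep
    𝔼-cost zero = begin
      𝔼 law {1} (fromℕ ∘ cost)
        ≈⟨ 𝔼-cong {1} (fromℕ ∘ cost) (λ _ → fromℕ 132) (λ { (u ∷ []) → reflexive (≡.cong fromℕ (attachmentCost-[] u)) }) ⟩
      𝔼 law {1} (λ _ → fromℕ 132)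
        ≈⟨ 𝔼-const 1 (fromℕ 132) ⟩
      fromℕ 132                  ≈⟨ solve 4 (λ a b d m → a := a :+ b :* con 0 :+ d :* (con 0 :* num 1) :* m) refl
                                       (fromℕ 132) (fromℕ 127) (fromℕ 60) meanStep ⟩
      fromℕ 132 + fromℕ 127 * 0# + fromℕ 60 * (0# * fromℕ 1) * meanStep ∎
    𝔼-cost (suc k) = begin
      𝔼 law {suc (suc k)} (fromℕ ∘ cost)
        ≈⟨ 𝔼-cong (fromℕ ∘ cost) (λ us → const us + growth us + previous us) split ⟩
      𝔼 law (λ us → const us + growth us + previous us)
        ≈⟨ trans (𝔼-+ (λ us → const us + growth us) previous) (+-congʳ (𝔼-+ const growth)) ⟩
      𝔼 law const + 𝔼 law growth + 𝔼 law previous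
        ≈⟨ +-cong (+-cong (𝔼-const (suc (suc k)) (fromℕ 127))
                          (trans (𝔼-*ʳ step (fromℕ 120 * n)) (*-congʳ (𝔼-head k))))
                  (trans (𝔼-tail {suc k} (fromℕ ∘ cost)) (𝔼-cost k)) ⟩
      fromℕ 127 + meanStep * (fromℕ 120 * n) + (fromℕ 132 + fromℕ 127 * fromℕ k + fromℕ 60 * (fromℕ k * n) * meanStep)
        ≈⟨ solve 2 (λ x m →
             num 127 :+ m :* (num 120 :* (con 1 :+ x)) :+ (num 132 :+ num 127 :* x :+ num 60 :* (x :* (con 1 :+ x)) :* m)
               := num 132 :+ num 127 :* (con 1 :+ x) :+ num 60 :* ((con 1 :+ x) :* (con 1 :+ (con 1 :+ x))) :* m)
             refl (fromℕ k) meanStep ⟩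
      fromℕ 132 + fromℕ 127 * n + fromℕ 60 * (n * fromℕ (suc (suc k))) * meanStep ∎
      where
      n = fromℕ (suc k)
      const step growth previous : Vec (Fin 5) (suc (suc k)) → Carrier
      const us = fromℕ 127
      step us = fromℕ (suc (depth (head us)))
      growth us = step us * (fromℕ 120 * n)
      previous us = fromℕ (cost (tail us))
      split : ∀ us → fromℕ (cost us) ≈ const us + growth us + previous us
      split (v ∷ u ∷ us) = begin
        fromℕ (attachmentCost (u ∷ us) v)
          ≈⟨ reflexive (≡.cong fromℕ (attachmentCost-∷ us u v)) ⟩
        fromℕ (127 ℕ.+ suc (depth v) ℕ.* (120 ℕ.* suc k) ℕ.+ attachmentCost us u)
          ≈⟨ trans (fromℕ-+ (127 ℕ.+ suc (depth v) ℕ.* (120 ℕ.* suc k)) (attachmentCost us u))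
                   (+-congʳ (fromℕ-+ 127 (suc (depth v) ℕ.* (120 ℕ.* suc k)))) ⟩
        fromℕ 127 + fromℕ (suc (depth v) ℕ.* (120 ℕ.* suc k)) + fromℕ (attachmentCost us u)
          ≈⟨ +-congʳ (+-congˡ (trans (fromℕ-* (suc (depth v)) (120 ℕ.* suc k)) (*-congˡ (fromℕ-* 120 (suc k))))) ⟩
        fromℕ 127 + fromℕ (suc (depth v)) * (fromℕ 120 * n) + fromℕ (attachmentCost us u) ∎

    𝔼-schultz-suc : ∀ k → 𝔼 law {suc k} (λ us → fromℕ (schultz (PG us)))
      ≈ fromℕ 302 + fromℕ 247 * fromℕ k + 𝔼 law {suc k} (fromℕ ∘ cost) + 𝔼 law {k} (λ us → fromℕ (schultz (PG us)))
    𝔼-schultz-suc k = begin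
      𝔼 law {suc k} (λ us → fromℕ (schultz (PG us)))
        ≈⟨ 𝔼-cong (fromℕ ∘ S) (λ us → const us + fromℕ (cost us) + previous us) split ⟩
      𝔼 law {suc k} (λ us → const us + fromℕ (cost us) + previous us)
        ≈⟨ trans (𝔼-+ (λ us → const us + fromℕ (cost us)) previous) (+-congʳ (𝔼-+ const (fromℕ ∘ cost))) ⟩
      𝔼 law const + 𝔼 law {suc k} (fromℕ ∘ cost) + 𝔼 law previous
        ≈⟨ +-cong (+-congʳ (𝔼-const (suc k) a)) (𝔼-tail {k} (fromℕ ∘ S)) ⟩
      a + 𝔼 law {suc k} (fromℕ ∘ cost) + 𝔼 law {k} (λ us → fromℕ (schultz (PG us))) ∎
      where
      a : Carrier
      a = fromℕ 302 + fromℕ 247 * fromℕ k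
      S : ∀ {j} → Vec (Fin 5) j → ℕ
      S us = schultz (PG us)
      const previous : Vec (Fin 5) (suc k) → Carrier
      const us = a
      previous us = fromℕ (S (tail us))
      split : ∀ us → fromℕ (S us) ≈ const us + fromℕ (cost us) + previous us
      split (u ∷ us) = begin
        fromℕ (S (u ∷ us))
          ≈⟨ reflexive (≡.cong fromℕ (schultz-PG-∷ us u)) ⟩
        fromℕ (302 ℕ.+ 247 ℕ.* k ℕ.+ attachmentCost us u ℕ.+ S us)
          ≈⟨ trans (fromℕ-+ (302 ℕ.+ 247 ℕ.* k ℕ.+ attachmentCost us u) (S us))
                   (+-congʳ (fromℕ-+ (302 ℕ.+ 247 ℕ.* k) (attachmentCost us u))) ⟩
        fromℕ (302 ℕ.+ 247 ℕ.* k) + fromℕ (attachmentCost us u) + fromℕ (S us)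
          ≈⟨ +-congʳ (+-congʳ (trans (fromℕ-+ 302 (247 ℕ.* k)) (+-congˡ (fromℕ-* 247 k)))) ⟩
        a + fromℕ (attachmentCost us u) + fromℕ (S us) ∎

    -- The closed form with its negative terms moved to the left.
    𝔼-schultz : ∀ k → let n = fromℕ (suc k) in
      𝔼 law {k} (λ us → fromℕ (schultz (PG us))) + (fromℕ 20 * p₁ * n ^ 3 + (fromℕ 40 * p₁ + fromℕ 7) * n)
        ≈ fromℕ 60 * n ^ 3 + (fromℕ 60 * p₁ + fromℕ 7) * n ^ 2
    -- The empty history has probability 1, and the pentagon has Schultz index 60.
    𝔼-schultz zero = solve 1 (λ p →
      con 1 :* num 60 :+ (num 20 :* p :* cube (num 1) :+ (num 40 :* p :+ num 7) :* num 1)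
        := num 60 :* cube (num 1) :+ (num 60 :* p :+ num 7) :* square (num 1)) refl p₁
      where
      square cube : ∀ {n} → Polynomial n → Polynomial n
      -- Mirrors the unfolding of `^`, which ends in a factor 1.
      square x = x :* (x :* con 1)
      cube x = x :* square x
    𝔼-schultz (suc k) = begin
      𝔼S (suc k) + (fromℕ 20 * p₁ * n′ ^ 3 + (fromℕ 40 * p₁ + fromℕ 7) * n′)
        ≈⟨ +-congʳ (trans (𝔼-schultz-suc k) (+-congʳ (+-congˡ (𝔼-cost k)))) ⟩
      fromℕ 302 + fromℕ 247 * x + (fromℕ 132 + fromℕ 127 * x + fromℕ 60 * (x * n) * meanStep) + 𝔼S k
        + (fromℕ 20 * p₁ * n′ ^ 3 + (fromℕ 40 * p₁ + fromℕ 7) * n′)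
        -- From n to n + 1 the terms moved to the left grow by 60 p₁ (n² + n + 1) + 7, and n² + n +
        -- 1 = x n + (3 + 2 x). The part 60 p₁ x n joins 60 x n `meanStep`, so that `meanStep`
        -- occurs only in `meanStep + p₁`.
        ≈⟨ solve 4 (λ x s p m →
             num 302 :+ num 247 :* x :+ (num 132 :+ num 127 :* x :+ num 60 :* (x :* (con 1 :+ x)) :* m) :+ s
               :+ (num 20 :* p :* cube (con 1 :+ (con 1 :+ x)) :+ (num 40 :* p :+ num 7) :* (con 1 :+ (con 1 :+ x)))
             := s :+ (num 20 :* p :* cube (con 1 :+ x) :+ (num 40 :* p :+ num 7) :* (con 1 :+ x))
               :+ (num 441 :+ num 374 :* x :+ num 60 :* p :* (num 3 :+ num 2 :* x) :+ num 60 :* (x :* (con 1 :+ x)) :* (m :+ p)))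
             refl x (𝔼S k) p₁ meanStep ⟩
      𝔼S k + (fromℕ 20 * p₁ * n ^ 3 + (fromℕ 40 * p₁ + fromℕ 7) * n)
        + (fromℕ 441 + fromℕ 374 * x + fromℕ 60 * p₁ * (fromℕ 3 + fromℕ 2 * x) + fromℕ 60 * (x * n) * (meanStep + p₁))
        ≈⟨ +-cong (𝔼-schultz k) (+-congˡ (*-congˡ meanStep+p₁≈3)) ⟩
      fromℕ 60 * n ^ 3 + (fromℕ 60 * p₁ + fromℕ 7) * n ^ 2
        + (fromℕ 441 + fromℕ 374 * x + fromℕ 60 * p₁ * (fromℕ 3 + fromℕ 2 * x) + fromℕ 60 * (x * n) * fromℕ 3)
        ≈⟨ solve 2 (λ x p →
             num 60 :* cube (con 1 :+ x) :+ (num 60 :* p :+ num 7) :* square (con 1 :+ x)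
               :+ (num 441 :+ num 374 :* x :+ num 60 :* p :* (num 3 :+ num 2 :* x) :+ num 60 :* (x :* (con 1 :+ x)) :* num 3)
             := num 60 :* cube (con 1 :+ (con 1 :+ x)) :+ (num 60 :* p :+ num 7) :* square (con 1 :+ (con 1 :+ x)))
             refl x p₁ ⟩
      fromℕ 60 * n′ ^ 3 + (fromℕ 60 * p₁ + fromℕ 7) * n′ ^ 2 ∎
      where
      x = fromℕ k
      n = fromℕ (suc k)
      n′ = fromℕ (suc (suc k))
      𝔼S : ℕ → Carrier
      𝔼S k = 𝔼 law {k} (λ us → fromℕ (schultz (PG us)))
      square cube : ∀ {n} → Polynomial n → Polynomial n
      square x = x :* (x :* con 1)
      cube x = x :* square x

theorem2p2 : ∀ {c ℓ₁ ℓ₂} (R : OrderedCommutativeRing c ℓ₁ ℓ₂) →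
    let open OrderedCommutativeRing R
        open Random R
    in (p₁ : Carrier) → 0# ≤ p₁ → p₁ ≤ 1# → (law : AttachmentLaw p₁) →
       (k : ℕ) →
       let n = fromℕ (suc k)
       in 𝔼 law {k} (λ us → fromℕ (schultz (PG us)))
            ≈ (fromℕ 60 - fromℕ 20 * p₁) * n ^ 3
              + (fromℕ 60 * p₁ + fromℕ 7) * n ^ 2
              - (fromℕ 40 * p₁ + fromℕ 7) * n
-- `t` is n³, the power whose coefficient contains a difference.
theorem2p2 R p₁ _ _ law k = subtract (fromℕ (suc k) ^ 3) (𝔼-schultz law k)
  where
  open OrderedCommutativeRing R
  open Expectation R
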